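{- Let $D$ be a Dedekind domain, $r\ge 1$, and let $I_1,\ldots,I_r,J$ be ideals of $D$ with $I_i\neq 0,D$ and $J\neq 0,D$. For each $i$ fix a complete set of residues $\mathcal{D}_{I_i}\subseteq D$ modulo $I_i$ with $0\in\mathcal{D}_{I_i}$. Then every function $f:\mathcal{D}_{I_1}\times\cdots\times\mathcal{D}_{I_r}\to D/J$ is a polynomial function (in the sense defined in the context) if and only if for every $i\in\{1,\ldots,r\}$ and every prime ideal $P$ of $D$ dividing $J$, no two distinct elements of $\mathcal{D}_{I_i}$ are congruent modulo $P$.
   Context: The set $\mathcal{D}_{I_i}$ is identified with $D/I_i$, so functions $D/I_1\times\cdots\times D/I_r\to D/J$ are functions on $\mathcal{D}_{I_1}\times\cdots\times\mathcal{D}_{I_r}$. Such a function $f$ is called a polynomial function if there is a polynomial $F\in D[x_1,\ldots,x_r]$ with $F(b_1,\ldots,b_r)\equiv f(b_1,\ldots,b_r)\pmod J$ for all $(b_1,\ldots,b_r)\in\mathcal{D}_{I_1}\times\cdots\times\mathcal{D}_{I_r}$ (here $F$ is evaluated at $(b_1,\ldots,b_r)\in D^r$).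
   Formalization: The formal theorem additionally assumes that every residue ring D/I_i is finite; without this the equivalence fails, e.g. for D = ℚ[t], r = 1, I_1 = J = (t) with residues ℚ, where the indicator function of 0 is not polynomial. -}

module Defs where

open import Algebra.Bundles using (CommutativeRing; RawSemiring; Semiring)
open import Data.Fin.Base using (Fin; toℕ)
open import Data.List.Base using (List; foldr)
open import Data.Nat.Base using (ℕ)
open import Data.Product using (Σ; ∃; ∃-syntax; _×_; _,_; proj₁; proj₂)
open import Data.Sum.Base using (_⊎_; inj₁; inj₂)
open import Data.Vec.Functional using (Vector)
import Data.Vec.Functional.Relation.Binary.Equality.Setoid as VecEq
open import Function.Bundles using (Func; Inverse)
open import Level using (Level; suc; _⊔_)
open import Relation.Binary.Bundles using (Setoid)
import Relation.Binary.Construct.On as On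
open import Relation.Binary.PropositionalEquality.Properties using (setoid)
open import Relation.Nullary.Negation.Core using (¬_)
open import Relation.Unary using (Pred; _∈_; _⊆_; _≐_; U)
import Algebra.Definitions.RawSemiring as RawSemiringDefs
import Algebra.Properties.Ring as RingProperties
import Relation.Binary.Reasoning.Setoid as SetoidReasoning

Finite : ∀ {a ℓ} → Setoid a ℓ → Set (a ⊔ ℓ)
Finite S = ∃[ n ] Inverse S (setoid (Fin n))

module _ {c ℓ : Level} (R : CommutativeRing c ℓ) where

  open CommutativeRing R
  open RingProperties ring using (-1*x≈-x; -‿+-comm; -‿involutive)
  open RawSemiringDefs (Semiring.rawSemiring semiring) using (_^_; sum; product)

  -- Closure under negation follows from *-closed.
  record Ideal : Set (suc (c ⊔ ℓ)) where
    field
      ⟦_⟧      : Pred Carrier (c ⊔ ℓ)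
      resp     : ∀ {x y} → x ≈ y → x ∈ ⟦_⟧ → y ∈ ⟦_⟧
      0∈       : 0# ∈ ⟦_⟧
      +-closed : ∀ {x y} → x ∈ ⟦_⟧ → y ∈ ⟦_⟧ → x + y ∈ ⟦_⟧
      *-closed : ∀ a {x} → x ∈ ⟦_⟧ → a * x ∈ ⟦_⟧

  open Ideal public using (⟦_⟧)

  IsZeroIdeal : Ideal → Set (c ⊔ ℓ)
  IsZeroIdeal I = ⟦ I ⟧ ≐ (_≈ 0#)

  IsUnitIdeal : Ideal → Set (c ⊔ ℓ)
  IsUnitIdeal I = ⟦ I ⟧ ≐ U

  Span : ∀ {n} → Vector Carrier n → Pred Carrier (c ⊔ ℓ)
  Span {n} g x = Σ (Vector Carrier n) λ a → x ≈ sum (λ k → a k * g k)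

  IsFinitelyGenerated : Ideal → Set (c ⊔ ℓ)
  IsFinitelyGenerated I = ∃[ n ] Σ (Vector Carrier n) λ g → ⟦ I ⟧ ≐ Span g

  -- The product I J: finite sums of products a b with a ∈ I and b ∈ J.
  _·_ : Ideal → Ideal → Pred Carrier (c ⊔ ℓ)
  (I · J) x = ∃[ n ] Σ (Vector Carrier n) λ a → Σ (Vector Carrier n) λ b →
    (∀ k → a k ∈ ⟦ I ⟧) × (∀ k → b k ∈ ⟦ J ⟧) × x ≈ sum (λ k → a k * b k)

  _Divides_ : Ideal → Ideal → Set (suc (c ⊔ ℓ))
  P Divides J = Σ Ideal λ Q → ⟦ J ⟧ ≐ (P · Q)

  record IsPrimeIdeal (P : Ideal) : Set (c ⊔ ℓ) where
    field
      proper : ¬ IsUnitIdeal P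
      split  : ∀ x y → x * y ∈ ⟦ P ⟧ → x ∈ ⟦ P ⟧ ⊎ y ∈ ⟦ P ⟧

  record IsMaximalIdeal (M : Ideal) : Set (suc (c ⊔ ℓ)) where
    field
      proper  : ¬ IsUnitIdeal M
      maximal : ∀ (K : Ideal) → ⟦ M ⟧ ⊆ ⟦ K ⟧ → (⟦ K ⟧ ≐ ⟦ M ⟧) ⊎ IsUnitIdeal K

  record IsIntegralDomain : Set (c ⊔ ℓ) where
    field
      1≉0            : ¬ 1# ≈ 0#
      noZeroDivisors : ∀ x y → x * y ≈ 0# → x ≈ 0# ⊎ y ≈ 0#

  module FractionField (domain : IsIntegralDomain) where

    open IsIntegralDomain domain

    record Fraction : Set (c ⊔ ℓ) where
      constructor _/_[_]
      field
        num   : Carrier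
        den   : Carrier
        den≉0 : ¬ den ≈ 0#

    *-nonzero : ∀ {x y} → ¬ x ≈ 0# → ¬ y ≈ 0# → ¬ x * y ≈ 0#
    *-nonzero {x} {y} x≉0 y≉0 xy≈0 with noZeroDivisors x y xy≈0
    ... | inj₁ x≈0 = x≉0 x≈0
    ... | inj₂ y≈0 = y≉0 y≈0

    fromRing : Carrier → Fraction
    fromRing x = x / 1# [ 1≉0 ]

    fractions : RawSemiring (c ⊔ ℓ) ℓ
    fractions = record
      { Carrier = Fraction
      ; _≈_     = λ (a / b [ _ ]) (a′ / b′ [ _ ]) → a * b′ ≈ a′ * b
      ; _+_     = λ (a / b [ p ]) (a′ / b′ [ p′ ]) →
                    (a * b′ + a′ * b) / (b * b′) [ *-nonzero p p′ ]
      ; _*_     = λ (a / b [ p ]) (a′ / b′ [ p′ ]) →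
                    (a * a′) / (b * b′) [ *-nonzero p p′ ]
      ; 0#      = fromRing 0#
      ; 1#      = fromRing 1#
      }

    private
      module K = RawSemiring fractions
      module KD = RawSemiringDefs fractions

    -- z is a root of the monic polynomial Xⁿ + Σ_{k<n} a_k Xᵏ over the ring.
    IsIntegral : Fraction → Set (c ⊔ ℓ)
    IsIntegral z = ∃[ n ] Σ (Vector Carrier n) λ a →
      ((z KD.^ n) K.+ KD.sum (λ k → fromRing (a k) K.* (z KD.^ toℕ k))) K.≈ K.0#

    IsIntegrallyClosed : Set (c ⊔ ℓ)
    IsIntegrallyClosed = ∀ z → IsIntegral z → ∃[ x ] z K.≈ fromRing x

  record IsDedekindDomain : Set (suc (c ⊔ ℓ)) where
    field
      isIntegralDomain   : IsIntegralDomain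
      noetherian         : ∀ I → IsFinitelyGenerated I
      isIntegrallyClosed : FractionField.IsIntegrallyClosed isIntegralDomain
      prime⇒maximal      : ∀ P → IsPrimeIdeal P → ¬ IsZeroIdeal P → IsMaximalIdeal P

  infix 4 _≡_mod_

  _≡_mod_ : Carrier → Carrier → Ideal → Set (c ⊔ ℓ)
  x ≡ y mod I = x - y ∈ ⟦ I ⟧

  Residues : Ideal → Setoid c (c ⊔ ℓ)
  Residues I = record
    { Carrier       = Carrier
    ; _≈_           = λ x y → x ≡ y mod I
    ; isEquivalence = record
      { refl  = I.resp (sym (-‿inverseʳ _)) I.0∈
      ; sym   = λ {x} {y} p → I.resp (neg-diff x y) (I.*-closed (- 1#) p)
      ; trans = λ {x} {y} {z} p q → I.resp (add-diff x y z) (I.+-closed p q)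
      }
    }
    where
    module I = Ideal I
    open SetoidReasoning (CommutativeRing.setoid R)

    neg-diff : ∀ x y → - 1# * (x - y) ≈ y - x
    neg-diff x y = begin
      - 1# * (x - y)  ≈⟨ -1*x≈-x (x - y) ⟩
      - (x - y)       ≈⟨ -‿+-comm x (- y) ⟨
      - x + - - y     ≈⟨ +-congˡ (-‿involutive y) ⟩
      - x + y         ≈⟨ +-comm (- x) y ⟩
      y - x           ∎

    add-diff : ∀ x y z → (x - y) + (y - z) ≈ x - z
    add-diff x y z = begin
      (x - y) + (y - z)      ≈⟨ +-assoc x (- y) (y - z) ⟩
      x + (- y + (y - z))    ≈⟨ +-congˡ (+-assoc (- y) y (- z)) ⟨
      x + ((- y + y) - z)    ≈⟨ +-congˡ (+-congʳ (-‿inverseˡ y)) ⟩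
      x + (0# - z)           ≈⟨ +-congˡ (+-identityˡ (- z)) ⟩
      x - z                  ∎

  record CompleteResidues (I : Ideal) : Set (suc (c ⊔ ℓ)) where
    field
      elements : Pred Carrier (c ⊔ ℓ)
      resp     : ∀ {x y} → x ≈ y → x ∈ elements → y ∈ elements
      exists   : ∀ x → ∃[ s ] s ∈ elements × x ≡ s mod I
      unique   : ∀ {s t} → s ∈ elements → t ∈ elements → s ≡ t mod I → s ≈ t

  open CompleteResidues public using (elements)

  -- A polynomial in r variables is presented as a formal finite sum of
  -- monomials a x₁^e₁ ⋯ x_r^e_r; repeated exponent vectors are allowed.
  Polynomial : ℕ → Set c
  Polynomial r = List (Carrier × Vector ℕ r)

  evaluate : ∀ {r} → Polynomial r → Vector Carrier r → Carrier
  evaluate F x = foldr (λ (a , e) s → a * product (λ i → x i ^ e i) + s) 0# F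

  module _ {r : ℕ} {I : Fin r → Ideal} (𝒟 : ∀ i → CompleteResidues (I i)) where

    -- 𝒟₁ × ⋯ × 𝒟_r; membership proofs play no part in the equality.
    Tuples : Setoid (c ⊔ ℓ) ℓ
    Tuples = On.setoid {B = Σ (Vector Carrier r) λ b → ∀ i → b i ∈ elements (𝒟 i)}
      (VecEq.≋-setoid (CommutativeRing.setoid R) r) proj₁

    IsPolynomialFunction : (J : Ideal) → Func Tuples (Residues J) → Set (c ⊔ ℓ)
    IsPolynomialFunction J f = Σ (Polynomial r) λ F →
      ∀ b → evaluate F (proj₁ b) ≡ Func.to f b mod J

{-# OPTIONS --safe #-}

-- If x ≡ y modulo a prime P dividing J, then a polynomial takes congruent values modulo P at the
-- tuples with x, respectively y, in place i and 0 elsewhere, so it cannot represent modulo J the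
-- indicator function of "the i-th coordinate is x".  Conversely, if x - y lies in no prime divisor
-- of J, then x - y is a unit modulo J: a prime containing J + (x - y) would divide J.  Newton
-- interpolation in D / J over the finitely many tuples then represents every function.
--
-- That a prime P containing J ≠ 0 divides J is shown without factorisation into primes.  For
-- 0 ≠ a ∈ P the localisation at P of D / (a) has an element with maximal annihilator among the
-- proper ones; the annihilator is prime, hence P, and clearing denominators gives d ∉ (a) with
-- d P ⊆ (a).  As d / a is not integral, (d / a) P ⊈ P, so P + (d / a) P = D, which makes P
-- invertible.
module Submission where

open import Defs
open import Algebra.Bundles using (CommutativeRing; RawSemiring; Semiring)
open import Axiom.ExcludedMiddle using (ExcludedMiddle)
open import Data.Fin.Base using (Fin; zero; suc; toℕ)
open import Data.Fin.Properties using (all?; ¬∀⟶∃¬) renaming (_≟_ to _≟ᶠ_)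
open import Data.List.Base as List using (List; []; _∷_; _++_; allFin; cartesianProductWith)
open import Data.List.Membership.Propositional.Properties using (∈-allFin)
open import Data.List.Relation.Unary.All as All using (All; []; _∷_)
open import Data.List.Relation.Unary.Any as Any using (Any; here; there)
import Data.List.Relation.Unary.Any.Properties as Any
open import Data.Nat.Base as ℕ using (ℕ; _≤_)
open import Data.Nat.GeneralisedArithmetic using (fold)
import Data.Nat.Properties as ℕ
open import Data.Product using (Σ; ∃-syntax; _×_; _,_; proj₁; proj₂)
open import Data.Sum.Base using (_⊎_; inj₁; inj₂)
open import Data.Vec.Functional as Vector using (Vector)
open import Function.Base using (_∘_)
open import Function.Bundles using (Func; Inverse; _⇔_; mk⇔)
open import Level using (Level; Lift; lift; lower; _⊔_) renaming (suc to lsuc)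
open import Relation.Binary.Bundles using (Setoid)
open import Relation.Binary.PropositionalEquality as ≡ using (_≡_)
open import Relation.Nullary.Decidable using (Dec; yes; no; map′; decidable-stable)
open import Relation.Nullary.Negation.Core using (¬_; contradiction)
open import Relation.Unary using (Pred; _∈_; _∉_; _⊆_; _≐_)
import Algebra.Definitions.RawSemiring as RawSemiringDefs
import Algebra.Properties.AbelianGroup as AbelianGroupProperties
import Algebra.Properties.CommutativeMonoid.Sum as CommutativeMonoidSum
import Algebra.Properties.Ring as RingProperties
import Algebra.Properties.Semiring.Exp as Exp
import Algebra.Solver.Ring.NaturalCoefficients.Default as SemiringSolver
import Relation.Binary.Reasoning.Setoid as SetoidReasoning

-- Arithmetic of formal polynomials and its compatibility with evaluation.

module Polynomials {c ℓ} (R : CommutativeRing c ℓ) where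

  open CommutativeRing R hiding (zero)
  open RawSemiringDefs (Semiring.rawSemiring semiring) using (_^_; product)
  open Exp semiring using (^-congˡ; ^-homo-*)
  open CommutativeMonoidSum *-commutativeMonoid using ()
    renaming (sum-cong-≋ to product-cong; sum-replicate-zero to product-replicate-one;
              ∑-distrib-+ to product-distrib-*)
  open SemiringSolver commutativeSemiring using (solve; _:=_; _:+_; _:*_)
  open SetoidReasoning setoid

  private variable r : ℕ

  monomial : Vector ℕ r → Vector Carrier r → Carrier
  monomial e x = product (λ i → x i ^ e i)

  evaluate-cong : ∀ (F : Polynomial R r) {x y} → (∀ i → x i ≈ y i) →
                  evaluate R F x ≈ evaluate R F y
  evaluate-cong []            x≋y = refl
  evaluate-cong ((a , e) ∷ F) x≋y =
    +-cong (*-congˡ (product-cong (λ i → ^-congˡ (e i) (x≋y i)))) (evaluate-cong F x≋y)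

  evaluate-++ : ∀ (F G : Polynomial R r) x →
                evaluate R (F ++ G) x ≈ evaluate R F x + evaluate R G x
  evaluate-++ []            G x = sym (+-identityˡ _)
  evaluate-++ ((a , e) ∷ F) G x = begin
    a * monomial e x + evaluate R (F ++ G) x                ≈⟨ +-congˡ (evaluate-++ F G x) ⟩
    a * monomial e x + (evaluate R F x + evaluate R G x)    ≈⟨ +-assoc _ _ _ ⟨
    a * monomial e x + evaluate R F x + evaluate R G x      ∎

  infixr 7 _·ᵐ_ _⊛_

  _·ᵐ_ : Carrier × Vector ℕ r → Polynomial R r → Polynomial R r
  (a , e) ·ᵐ F = List.map (λ (b , d) → a * b , λ i → e i ℕ.+ d i) F

  _⊛_ : Polynomial R r → Polynomial R r → Polynomial R r
  []      ⊛ G = []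
  (m ∷ F) ⊛ G = m ·ᵐ G ++ F ⊛ G

  monomial-+ : ∀ (e d : Vector ℕ r) x →
               monomial (λ i → e i ℕ.+ d i) x ≈ monomial e x * monomial d x
  monomial-+ e d x = begin
    product (λ i → x i ^ (e i ℕ.+ d i))         ≈⟨ product-cong (λ i → ^-homo-* (x i) (e i) (d i)) ⟩
    product (λ i → x i ^ e i * x i ^ d i)       ≈⟨ product-distrib-* (λ i → x i ^ e i) (λ i → x i ^ d i) ⟩
    monomial e x * monomial d x                 ∎

  evaluate-·ᵐ : ∀ a e (F : Polynomial R r) x →
                evaluate R ((a , e) ·ᵐ F) x ≈ a * monomial e x * evaluate R F x
  evaluate-·ᵐ a e []            x = sym (zeroʳ _)
  evaluate-·ᵐ a e ((b , d) ∷ F) x = begin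
    a * b * monomial (λ i → e i ℕ.+ d i) x + evaluate R ((a , e) ·ᵐ F) x
      ≈⟨ +-cong (*-congˡ (monomial-+ e d x)) (evaluate-·ᵐ a e F x) ⟩
    a * b * (monomial e x * monomial d x) + a * monomial e x * evaluate R F x
      ≈⟨ solve 5 (λ a b p q s → a :* b :* (p :* q) :+ a :* p :* s := a :* p :* (b :* q :+ s))
           refl a b (monomial e x) (monomial d x) (evaluate R F x) ⟩
    a * monomial e x * (b * monomial d x + evaluate R F x)  ∎

  evaluate-⊛ : ∀ (F G : Polynomial R r) x →
               evaluate R (F ⊛ G) x ≈ evaluate R F x * evaluate R G x
  evaluate-⊛ []            G x = sym (zeroˡ _)
  evaluate-⊛ ((a , e) ∷ F) G x = begin
    evaluate R ((a , e) ·ᵐ G ++ F ⊛ G) x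
      ≈⟨ evaluate-++ ((a , e) ·ᵐ G) (F ⊛ G) x ⟩
    evaluate R ((a , e) ·ᵐ G) x + evaluate R (F ⊛ G) x
      ≈⟨ +-cong (evaluate-·ᵐ a e G x) (evaluate-⊛ F G x) ⟩
    a * monomial e x * evaluate R G x + evaluate R F x * evaluate R G x
      ≈⟨ distribʳ _ _ _ ⟨
    (a * monomial e x + evaluate R F x) * evaluate R G x  ∎

  const : Carrier → Polynomial R r
  const a = (a , λ _ → 0) ∷ []

  evaluate-const : ∀ a (x : Vector Carrier r) → evaluate R (const a) x ≈ a
  evaluate-const {r} a x = begin
    a * monomial (λ _ → 0) x + 0#  ≈⟨ +-identityʳ _ ⟩
    a * monomial (λ _ → 0) x       ≈⟨ *-congˡ (product-replicate-one r) ⟩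
    a * 1#                         ≈⟨ *-identityʳ a ⟩
    a                              ∎

  unitVector : Fin r → Vector ℕ r
  unitVector zero    = 1 Vector.∷ λ _ → 0
  unitVector (suc i) = 0 Vector.∷ unitVector i

  monomial-unitVector : ∀ i (x : Vector Carrier r) → monomial (unitVector i) x ≈ x i
  monomial-unitVector {ℕ.suc r} zero x = begin
    x zero * 1# * product {r} (λ _ → 1#)  ≈⟨ *-congˡ (product-replicate-one r) ⟩
    x zero * 1# * 1#                      ≈⟨ *-identityʳ _ ⟩
    x zero * 1#                           ≈⟨ *-identityʳ _ ⟩
    x zero                                ∎
  monomial-unitVector (suc i) x = trans (*-identityˡ _) (monomial-unitVector i (x ∘ suc))

  var : Fin r → Polynomial R r
  var i = (1# , unitVector i) ∷ []

  evaluate-var : ∀ i (x : Vector Carrier r) → evaluate R (var i) x ≈ x i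
  evaluate-var i x = begin
    1# * monomial (unitVector i) x + 0#  ≈⟨ +-identityʳ _ ⟩
    1# * monomial (unitVector i) x       ≈⟨ *-identityˡ _ ⟩
    monomial (unitVector i) x            ≈⟨ monomial-unitVector i x ⟩
    x i                                  ∎

  -- With b the negative of a coordinate of a node, these are the normalised linear factors of
  -- Newton interpolation.
  evaluate-linear : ∀ u i b (x : Vector Carrier r) →
                    evaluate R (const u ⊛ (var i ++ const b)) x ≈ u * (x i + b)
  evaluate-linear u i b x = begin
    evaluate R (const u ⊛ (var i ++ const b)) x
      ≈⟨ evaluate-⊛ (const u) (var i ++ const b) x ⟩
    evaluate R (const u) x * evaluate R (var i ++ const b) x
      ≈⟨ *-cong (evaluate-const u x) (evaluate-++ (var i) (const b) x) ⟩
    u * (evaluate R (var i) x + evaluate R (const b) x)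
      ≈⟨ *-congˡ (+-cong (evaluate-var i x) (evaluate-const b x)) ⟩
    u * (x i + b)  ∎

  -- Newton interpolation at nodes whose differences are units.

  module Interpolation {p r} {P : Set p} (point : P → Vector Carrier r) (value : P → Carrier) where

    -- Different indices may name the same point. Asking for equal values as well ensures that such
    -- a repetition imposes no new condition on the interpolant.
    Agree : P → P → Set ℓ
    Agree p q = (∀ i → point p i ≈ point q i) × value p ≈ value q

    -- Mere inequality would not do: the ring may have zero divisors, and the linear factors have to
    -- be scaled to the value 1.
    Separated : P → P → Set (c ⊔ ℓ)
    Separated p q = ∃[ i ] ∃[ u ] u * (point p i - point q i) ≈ 1#

    module _ (agreeOrSeparated : ∀ p q → Agree p q ⊎ Separated p q) where

      -- The polynomial is a product with one factor u (x_i - q_i) for each q, where i and u come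
      -- from the separation of p and q. Each factor is 1 at p and 0 at its own q.
      bump : ∀ p qs → Any (Agree p) qs ⊎
             ∃[ N ] evaluate R N (point p) ≈ 1# × All (λ q → evaluate R N (point q) ≈ 0#) qs
      bump p []       = inj₂ (const 1# , evaluate-const 1# (point p) , [])
      bump p (q ∷ qs) with agreeOrSeparated p q | bump p qs
      ... | inj₁ agree         | _            = inj₁ (here agree)
      ... | inj₂ _             | inj₁ agree   = inj₁ (there agree)
      ... | inj₂ (i , u , u≈1) | inj₂ (N , N≈1 , N≈0) =
        inj₂ (L ⊛ N , LN≈1 , LN≈0 ∷ All.map LN≈0′ N≈0)
        where
        L : Polynomial R r
        L = const u ⊛ (var i ++ const (- point q i))

        LN≈1 : evaluate R (L ⊛ N) (point p) ≈ 1#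
        LN≈1 = begin
          evaluate R (L ⊛ N) (point p)
            ≈⟨ evaluate-⊛ L N (point p) ⟩
          evaluate R L (point p) * evaluate R N (point p)
            ≈⟨ *-cong (trans (evaluate-linear u i _ (point p)) u≈1) N≈1 ⟩
          1# * 1#
            ≈⟨ *-identityˡ 1# ⟩
          1#  ∎

        LN≈0 : evaluate R (L ⊛ N) (point q) ≈ 0#
        LN≈0 = begin
          evaluate R (L ⊛ N) (point q)
            ≈⟨ evaluate-⊛ L N (point q) ⟩
          evaluate R L (point q) * evaluate R N (point q)
            ≈⟨ *-congʳ (evaluate-linear u i _ (point q)) ⟩
          u * (point q i - point q i) * evaluate R N (point q)
            ≈⟨ *-congʳ (trans (*-congˡ (-‿inverseʳ _)) (zeroʳ u)) ⟩
          0# * evaluate R N (point q)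
            ≈⟨ zeroˡ _ ⟩
          0#  ∎

        LN≈0′ : ∀ {q′} → evaluate R N (point q′) ≈ 0# → evaluate R (L ⊛ N) (point q′) ≈ 0#
        LN≈0′ N≈0 = trans (evaluate-⊛ L N _) (trans (*-congˡ N≈0) (zeroʳ _))

      -- If p agrees with an index treated before, the polynomial for the others already has the
      -- right value at p. Otherwise a multiple of the bump corrects the value at p and changes none
      -- of the others.
      interpolate : ∀ ps → ∃[ F ] All (λ p → evaluate R F (point p) ≈ value p) ps
      interpolate []       = [] , []
      interpolate (p ∷ ps) with interpolate ps | bump p ps
      ... | F , F≈ | inj₁ agree = F , byAgreement F≈ agree ∷ F≈
        where
        byAgreement : ∀ {qs} → All (λ q → evaluate R F (point q) ≈ value q) qs →
                      Any (Agree p) qs → evaluate R F (point p) ≈ value p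
        byAgreement (F≈ ∷ _) (here (p≋q , p≈q)) = trans (evaluate-cong F p≋q) (trans F≈ (sym p≈q))
        byAgreement (_ ∷ F≈) (there agree)      = byAgreement F≈ agree
      ... | F , F≈ | inj₂ (N , N≈1 , N≈0) =
        F ++ const a ⊛ N , hits ∷ All.zipWith keeps (F≈ , N≈0)
        where
        -- The error of F at p. The bump is 1 there, so it is the coefficient needed.
        a : Carrier
        a = value p - evaluate R F (point p)

        corrected : ∀ x → evaluate R (F ++ const a ⊛ N) x ≈ evaluate R F x + a * evaluate R N x
        corrected x = trans (evaluate-++ F (const a ⊛ N) x)
          (+-congˡ (trans (evaluate-⊛ (const a) N x) (*-congʳ (evaluate-const a x))))

        hits : evaluate R (F ++ const a ⊛ N) (point p) ≈ value p
        hits = begin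
          evaluate R (F ++ const a ⊛ N) (point p)                ≈⟨ corrected (point p) ⟩
          evaluate R F (point p) + a * evaluate R N (point p)    ≈⟨ +-congˡ (*-congˡ N≈1) ⟩
          evaluate R F (point p) + a * 1#                        ≈⟨ +-congˡ (*-identityʳ a) ⟩
          evaluate R F (point p) + a                             ≈⟨ +-comm _ _ ⟩
          value p - evaluate R F (point p) + evaluate R F (point p)
            ≈⟨ AbelianGroupProperties.//-rightDividesˡ +-abelianGroup _ _ ⟩
          value p  ∎

        keeps : ∀ {q} → (evaluate R F (point q) ≈ value q) × (evaluate R N (point q) ≈ 0#) →
                evaluate R (F ++ const a ⊛ N) (point q) ≈ value q
        keeps {q} (F≈ , N≈0) = begin
          evaluate R (F ++ const a ⊛ N) (point q)                ≈⟨ corrected (point q) ⟩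
          evaluate R F (point q) + a * evaluate R N (point q)    ≈⟨ +-cong F≈ (*-congˡ N≈0) ⟩
          value q + a * 0#                                       ≈⟨ +-congˡ (zeroʳ a) ⟩
          value q + 0#                                           ≈⟨ +-identityʳ _ ⟩
          value q                                                ∎

-- Spans, sums, colon ideals and quotient rings.

module IdealProperties {c ℓ} (R : CommutativeRing c ℓ) where

  open CommutativeRing R hiding (zero)
  open RingProperties ring
  open RawSemiringDefs (Semiring.rawSemiring semiring) using (sum)
  open SemiringSolver commutativeSemiring using (solve; _:=_; _:+_; _:*_)
  open SetoidReasoning setoid

  neg-closed : ∀ (I : Ideal R) {x} → x ∈ ⟦ I ⟧ → - x ∈ ⟦ I ⟧
  neg-closed I x∈I = Ideal.resp I (-1*x≈-x _) (Ideal.*-closed I (- 1#) x∈I)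

  unitIdeal : ∀ (I : Ideal R) → 1# ∈ ⟦ I ⟧ → IsUnitIdeal R I
  unitIdeal I 1∈I = (λ _ → _) , λ {x} _ → Ideal.resp I (*-identityʳ x) (Ideal.*-closed I x 1∈I)

  1∉prime : ∀ {P : Ideal R} → IsPrimeIdeal R P → 1# ∉ ⟦ P ⟧
  1∉prime {P} prime 1∈P = IsPrimeIdeal.proper prime (unitIdeal P 1∈P)

  sum-closed : ∀ (I : Ideal R) {n} (x : Vector Carrier n) → (∀ k → x k ∈ ⟦ I ⟧) → sum x ∈ ⟦ I ⟧
  sum-closed I {ℕ.zero}  x x∈I = Ideal.0∈ I
  sum-closed I {ℕ.suc n} x x∈I = Ideal.+-closed I (x∈I zero) (sum-closed I (x ∘ suc) (x∈I ∘ suc))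

  span⊆ : ∀ (I : Ideal R) {n} (g : Vector Carrier n) → (∀ k → g k ∈ ⟦ I ⟧) → Span R g ⊆ ⟦ I ⟧
  span⊆ I g g∈I (a , x≈) = Ideal.resp I (sym x≈) (sum-closed I _ λ k → Ideal.*-closed I (a k) (g∈I k))

  divides⇒⊇ : ∀ {P J : Ideal R} → _Divides_ R P J → ⟦ J ⟧ ⊆ ⟦ P ⟧
  divides⇒⊇ {P} (Q , J≐PQ) x∈J with proj₁ J≐PQ x∈J
  ... | n , a , b , a∈P , _ , x≈ = Ideal.resp P (sym x≈)
    (sum-closed P _ λ k → Ideal.resp P (*-comm (b k) (a k)) (Ideal.*-closed P (b k) (a∈P k)))

  0*+ : ∀ x y → 0# * x + y ≈ y
  0*+ x y = trans (+-congʳ (zeroˡ x)) (+-identityˡ y)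

  span : ∀ {n} → Vector Carrier n → Ideal R
  span g = record
    { ⟦_⟧      = Span R g
    ; resp     = λ { x≈y (a , x≈) → a , trans (sym x≈y) x≈ }
    ; 0∈       = (λ _ → 0#) , sum-zero g
    ; +-closed = λ { (a , x≈) (b , y≈) → (λ k → a k + b k) , trans (+-cong x≈ y≈) (sum-+ a b g) }
    ; *-closed = λ { d (a , x≈) → (λ k → d * a k) , trans (*-congˡ x≈) (sum-* d a g) }
    }
    where
    sum-zero : ∀ {n} (g : Vector Carrier n) → 0# ≈ sum (λ k → 0# * g k)
    sum-zero {ℕ.zero}  g = refl
    sum-zero {ℕ.suc n} g = trans (sum-zero (g ∘ suc)) (sym (0*+ _ _))

    sum-+ : ∀ {n} (a b g : Vector Carrier n) →
            sum (λ k → a k * g k) + sum (λ k → b k * g k) ≈ sum (λ k → (a k + b k) * g k)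
    sum-+ {ℕ.zero}  a b g = +-identityˡ 0#
    sum-+ {ℕ.suc n} a b g = trans
      (solve 5 (λ a b g s t → (a :* g :+ s) :+ (b :* g :+ t) := (a :+ b) :* g :+ (s :+ t))
        refl (a zero) (b zero) (g zero) _ _)
      (+-congˡ (sum-+ (a ∘ suc) (b ∘ suc) (g ∘ suc)))

    sum-* : ∀ {n} d (a g : Vector Carrier n) →
            d * sum (λ k → a k * g k) ≈ sum (λ k → d * a k * g k)
    sum-* {ℕ.zero}  d a g = zeroʳ d
    sum-* {ℕ.suc n} d a g = trans
      (solve 4 (λ d a g s → d :* (a :* g :+ s) := d :* a :* g :+ d :* s)
        refl d (a zero) (g zero) _)
      (+-congˡ (sum-* d (a ∘ suc) (g ∘ suc)))

  generator∈span : ∀ {n} (g : Vector Carrier n) k → g k ∈ Span R g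
  generator∈span g zero with Ideal.0∈ (span (g ∘ suc))
  ... | a , 0≈ = 1# Vector.∷ a ,
                 sym (trans (+-cong (*-identityˡ _) (sym 0≈)) (+-identityʳ _))
  generator∈span g (suc k) with generator∈span (g ∘ suc) k
  ... | a , gk≈ = 0# Vector.∷ a , trans gk≈ (sym (0*+ _ _))

  -- The coefficients are padded with a zero at the end. Hence the spans of the initial segments of
  -- a sequence form an ascending chain.
  span-suc : ∀ (y : ℕ → Carrier) n →
             Span R {n} (y ∘ toℕ) ⊆ Span R {ℕ.suc n} (y ∘ toℕ)
  span-suc y ℕ.zero    (a , x≈) = (λ _ → 0#) , trans x≈ (sym (0*+ _ _))
  span-suc y (ℕ.suc n) (a , x≈) =
    let a′ , s≈ = span-suc (y ∘ ℕ.suc) n (a ∘ suc , refl)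
    in a zero Vector.∷ a′ , trans x≈ (+-congˡ s≈)

  last∈span : ∀ (y : ℕ → Carrier) n → y n ∈ Span R {ℕ.suc n} (y ∘ toℕ)
  last∈span y ℕ.zero    = (λ _ → 1#) , sym (trans (+-identityʳ _) (*-identityˡ _))
  last∈span y (ℕ.suc n) with last∈span (y ∘ ℕ.suc) n
  ... | b , yn≈ = 0# Vector.∷ b , trans yn≈ (sym (0*+ _ _))

  _+⟨_⟩ : Ideal R → Carrier → Ideal R
  I +⟨ w ⟩ = record
    { ⟦_⟧      = λ x → ∃[ i ] i ∈ ⟦ I ⟧ × ∃[ d ] x ≈ i + d * w
    ; resp     = λ { x≈y (i , i∈I , d , x≈) → i , i∈I , d , trans (sym x≈y) x≈ }
    ; 0∈       = 0# , I.0∈ , 0# , sym (trans (+-identityˡ _) (zeroˡ w))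
    ; +-closed = λ { (i , i∈I , d , x≈) (j , j∈I , e , y≈) →
                     i + j , I.+-closed i∈I j∈I , d + e ,
                     trans (+-cong x≈ y≈)
                       (solve 5 (λ i d j e w → (i :+ d :* w) :+ (j :+ e :* w) := (i :+ j) :+ (d :+ e) :* w)
                         refl i d j e w) }
    ; *-closed = λ { a (i , i∈I , d , x≈) →
                     a * i , I.*-closed a i∈I , a * d ,
                     trans (*-congˡ x≈)
                       (solve 4 (λ a i d w → a :* (i :+ d :* w) := a :* i :+ a :* d :* w)
                         refl a i d w) }
    }
    where module I = Ideal I

  ⊆+⟨⟩ : ∀ I w → ⟦ I ⟧ ⊆ ⟦ I +⟨ w ⟩ ⟧
  ⊆+⟨⟩ I w {x} x∈I = x , x∈I , 0# , sym (trans (+-congˡ (zeroˡ w)) (+-identityʳ x))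

  ∈+⟨⟩ : ∀ I w → w ∈ ⟦ I +⟨ w ⟩ ⟧
  ∈+⟨⟩ I w = 0# , Ideal.0∈ I , 1# , sym (trans (+-identityˡ _) (*-identityˡ w))

  -- The ideal (a) : d, that is, the annihilator of d in the module R / (a). The `Lift` only adjusts
  -- the universe level.
  colon : Carrier → Carrier → Ideal R
  colon a d = record
    { ⟦_⟧      = λ x → ∃[ w ] Lift (c ⊔ ℓ) (x * d ≈ w * a)
    ; resp     = λ { x≈y (w , lift xd≈wa) → w , lift (trans (*-congʳ (sym x≈y)) xd≈wa) }
    ; 0∈       = 0# , lift (trans (zeroˡ d) (sym (zeroˡ a)))
    ; +-closed = λ { {x} {y} (w , lift xd≈wa) (v , lift yd≈va) → w + v ,
                     lift (trans (distribʳ d x y)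
                       (trans (+-cong xd≈wa yd≈va) (sym (distribʳ a w v)))) }
    ; *-closed = λ { b {x} (w , lift xd≈wa) → b * w ,
                     lift (trans (*-assoc b x d)
                       (trans (*-congˡ xd≈wa) (sym (*-assoc b w a)))) }
    }

  colon-*ˡ : ∀ {a d} t → ⟦ colon a d ⟧ ⊆ ⟦ colon a (t * d) ⟧
  colon-*ˡ {a} {d} t {x} (w , lift xd≈wa) = t * w , lift (begin
    x * (t * d)  ≈⟨ solve 3 (λ x t d → x :* (t :* d) := t :* (x :* d)) refl x t d ⟩
    t * (x * d)  ≈⟨ *-congˡ xd≈wa ⟩
    t * (w * a)  ≈⟨ *-assoc t w a ⟨
    t * w * a    ∎)

  colon-cong : ∀ {a d d′} → d ≈ d′ → ⟦ colon a d ⟧ ⊆ ⟦ colon a d′ ⟧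
  colon-cong d≈d′ (w , lift xd≈wa) = w , lift (trans (*-congˡ (sym d≈d′)) xd≈wa)

  shiftʳ : ∀ {a d x y} → x * y ∈ ⟦ colon a d ⟧ → x ∈ ⟦ colon a (y * d) ⟧
  shiftʳ (w , lift eq) = w , lift (trans (sym (*-assoc _ _ _)) eq)

  shiftˡ : ∀ {a d x y} → x ∈ ⟦ colon a (y * d) ⟧ → x * y ∈ ⟦ colon a d ⟧
  shiftˡ (w , lift eq) = w , lift (trans (*-assoc _ _ _) eq)

  ≈⇒≡mod : ∀ I {x y} → x ≈ y → _≡_mod_ R x y I
  ≈⇒≡mod I x≈y =
    Ideal.resp I (sym (AbelianGroupProperties.x≈y⇒x∙y⁻¹≈ε +-abelianGroup x≈y)) (Ideal.0∈ I)

  -- The carrier and the operations are kept and only the equality is coarsened, so a polynomial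
  -- over R is literally a polynomial over the quotient.
  quotient : Ideal R → CommutativeRing c (c ⊔ ℓ)
  quotient I = record
    { Carrier = Carrier
    ; _≈_ = λ x y → _≡_mod_ R x y I
    ; _+_ = _+_ ; _*_ = _*_ ; -_ = -_ ; 0# = 0# ; 1# = 1#
    ; isCommutativeRing = record
      { isRing = record
        { +-isAbelianGroup = record
          { isGroup = record
            { isMonoid = record
              { isSemigroup = record
                { isMagma = record
                  { isEquivalence = Q.isEquivalence
                  ; ∙-cong = λ {x} {y} {u} {v} p q →
                      I.resp (begin
                        (x - y) + (u - v)          ≈⟨ solve 4 (λ x y′ u v′ → (x :+ y′) :+ (u :+ v′)
                                                          := (x :+ u) :+ (y′ :+ v′)) refl x (- y) u (- v) ⟩
                        (x + u) + (- y + - v)      ≈⟨ +-congˡ (-‿+-comm y v) ⟩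
                        (x + u) - (y + v)          ∎) (I.+-closed p q)
                  }
                ; assoc = λ x y z → ⌊ +-assoc x y z ⌋
                }
              ; identity = (λ x → ⌊ +-identityˡ x ⌋) , (λ x → ⌊ +-identityʳ x ⌋)
              }
            ; inverse = (λ x → ⌊ -‿inverseˡ x ⌋) , (λ x → ⌊ -‿inverseʳ x ⌋)
            ; ⁻¹-cong = λ {x} {y} p → I.resp (sym (-‿+-comm x (- y))) (neg-closed I p)
            }
          ; comm = λ x y → ⌊ +-comm x y ⌋
          }
        -- The congruence passes through y u: x u - y u = (x - y) u and y u - y v = y (u - v).
        ; *-cong = λ {x} {y} {u} {v} p q →
            Q.trans
              (I.resp ([y-z]x≈yx-zx u x y)
                 (I.resp (*-comm u (x - y)) (I.*-closed u p)))
              (I.resp (x[y-z]≈xy-xz y u v) (I.*-closed y q))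
        ; *-assoc = λ x y z → ⌊ *-assoc x y z ⌋
        ; *-identity = (λ x → ⌊ *-identityˡ x ⌋) , (λ x → ⌊ *-identityʳ x ⌋)
        ; distrib = (λ x y z → ⌊ distribˡ x y z ⌋) , (λ x y z → ⌊ distribʳ x y z ⌋)
        }
      ; *-comm = λ x y → ⌊ *-comm x y ⌋
      }
    }
    where
    module I = Ideal I
    module Q = Setoid (Residues R I)

    ⌊_⌋ : ∀ {x y} → x ≈ y → _≡_mod_ R x y I
    ⌊_⌋ = ≈⇒≡mod I

  module _ (I : Ideal R) where

    private
      module RD = RawSemiringDefs (Semiring.rawSemiring semiring)
      module QD = RawSemiringDefs (Semiring.rawSemiring (CommutativeRing.semiring (quotient I)))

    -- Both powers are recursions over operations that coincide definitionally, so induction gives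
    -- propositional equality. Congruences can then be transported between the two rings.
    ^-quotient : ∀ x n → x QD.^ n ≡ x RD.^ n
    ^-quotient x ℕ.zero    = ≡.refl
    ^-quotient x (ℕ.suc n) = ≡.cong (x *_) (^-quotient x n)

    monomial-quotient : ∀ {r} (e : Vector ℕ r) x →
                        Polynomials.monomial (quotient I) e x ≡ Polynomials.monomial R e x
    monomial-quotient {ℕ.zero}  e x = ≡.refl
    monomial-quotient {ℕ.suc r} e x =
      ≡.cong₂ _*_ (^-quotient (x zero) (e zero)) (monomial-quotient (e ∘ suc) (x ∘ suc))

    evaluate-quotient : ∀ {r} (F : Polynomial R r) x → evaluate (quotient I) F x ≡ evaluate R F x
    evaluate-quotient []            x = ≡.refl
    evaluate-quotient ((a , e) ∷ F) x =
      ≡.cong₂ _+_ (≡.cong (a *_) (monomial-quotient e x)) (evaluate-quotient F x)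

-- The ascending chain condition, maximal members of families, and prime ideals.

module Noetherian {c ℓ} (em : ExcludedMiddle (lsuc (c ⊔ ℓ)))
  (R : CommutativeRing c ℓ) (noetherian : ∀ I → IsFinitelyGenerated R I) where

  open CommutativeRing R hiding (zero)
  open IdealProperties R

  decide : (X : Set (c ⊔ ℓ)) → Dec X
  decide X = map′ lower lift (em {Lift (lsuc (c ⊔ ℓ)) X})

  ≈? : ∀ x y → Dec (x ≈ y)
  ≈? x y = map′ lower lift (decide (Lift (c ⊔ ℓ) (x ≈ y)))

  module _ (A : ℕ → Ideal R) (ascending : ∀ n → ⟦ A n ⟧ ⊆ ⟦ A (ℕ.suc n) ⟧) where

    ascending-≤ : ∀ {m n} → m ≤ n → ⟦ A m ⟧ ⊆ ⟦ A n ⟧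
    ascending-≤ {m} {n} m≤n x∈ = go (ℕ.≤⇒≤′ m≤n) x∈
      where
      go : ∀ {n} → m ℕ.≤′ n → ⟦ A m ⟧ ⊆ ⟦ A n ⟧
      go ℕ.≤′-refl        x∈ = x∈
      go (ℕ.≤′-step m≤′n) x∈ = ascending _ (go m≤′n x∈)

    ⋃ : Ideal R
    ⋃ = record
      { ⟦_⟧      = λ x → ∃[ n ] x ∈ ⟦ A n ⟧
      ; resp     = λ { x≈y (n , x∈) → n , Ideal.resp (A n) x≈y x∈ }
      ; 0∈       = 0 , Ideal.0∈ (A 0)
      ; +-closed = λ { (m , x∈) (n , y∈) → m ℕ.⊔ n ,
                       Ideal.+-closed (A (m ℕ.⊔ n)) (ascending-≤ (ℕ.m≤m⊔n m n) x∈)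
                                                    (ascending-≤ (ℕ.m≤n⊔m m n) y∈) }
      ; *-closed = λ { a (n , x∈) → n , Ideal.*-closed (A n) a x∈ }
      }

    -- The union of the chain is finitely generated, and a stage that contains all the generators
    -- contains the union.
    stabilises : ∃[ N ] ⟦ A (ℕ.suc N) ⟧ ⊆ ⟦ A N ⟧
    stabilises with noetherian ⋃
    ... | n , g , ⋃⊆span , span⊆⋃ =
      let N , g∈N = bound g (λ k → span⊆⋃ (generator∈span g k))
      in N , λ x∈ → span⊆ (A N) g g∈N (⋃⊆span (ℕ.suc N , x∈))
      where
      bound : ∀ {n} (g : Vector Carrier n) → (∀ k → g k ∈ ⟦ ⋃ ⟧) →
              ∃[ N ] ∀ k → g k ∈ ⟦ A N ⟧
      bound {ℕ.zero}  g g∈ = 0 , λ ()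
      bound {ℕ.suc n} g g∈ with g∈ zero | bound (g ∘ suc) (g∈ ∘ suc)
      ... | m , g₀∈ | N , g∈N = m ℕ.⊔ N , λ where
        zero    → ascending-≤ (ℕ.m≤m⊔n m N) g₀∈
        (suc k) → ascending-≤ (ℕ.m≤n⊔m m N) (g∈N k)

  -- Excluded middle for untruncated sums returns witnesses, so no choice axiom is needed.
  module _ {b} {B : Set (b ⊔ c ⊔ ℓ)} (em-b : ExcludedMiddle (b ⊔ c ⊔ ℓ)) (K : B → Ideal R) where

    Larger : B → Set (b ⊔ c ⊔ ℓ)
    Larger i = ∃[ j ] ⟦ K i ⟧ ⊆ ⟦ K j ⟧ × ¬ ⟦ K j ⟧ ⊆ ⟦ K i ⟧

    -- A member that cannot be enlarged is kept, so the chain of iterates stops growing only at a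
    -- maximal member. The decision is an argument so that the lemmas can match on it.
    enlarge : ∀ i → Dec (Larger i) → B
    enlarge i (yes (j , _)) = j
    enlarge i (no _)        = i

    enlarge-⊆ : ∀ i d → ⟦ K i ⟧ ⊆ ⟦ K (enlarge i d) ⟧
    enlarge-⊆ i (yes (_ , i⊆j , _)) = i⊆j
    enlarge-⊆ i (no _)              = λ x∈ → x∈

    enlarge-fixed : ∀ i d → ⟦ K (enlarge i d) ⟧ ⊆ ⟦ K i ⟧ → ¬ Larger i
    enlarge-fixed i (yes (_ , _ , j⊈i)) j⊆i = contradiction (λ {x} → j⊆i {x}) j⊈i
    enlarge-fixed i (no ¬larger)        _   = ¬larger

    chain : B → ℕ → B
    chain i ℕ.zero    = i
    chain i (ℕ.suc n) = enlarge (chain i n) em-b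

    maximalMember : B → ∃[ i ] ∀ j → ⟦ K i ⟧ ⊆ ⟦ K j ⟧ → ⟦ K j ⟧ ⊆ ⟦ K i ⟧
    maximalMember i₀ =
      let N , stable = stabilises (K ∘ chain i₀) (λ n → enlarge-⊆ (chain i₀ n) em-b)
      in chain i₀ N , λ j i⊆j {x} x∈ → decidable-stable (decide _) λ x∉ →
         enlarge-fixed (chain i₀ N) em-b stable (j , i⊆j , λ j⊆i → x∉ (j⊆i x∈))

  -- An ideal M that is maximal among the proper ideals above A is prime. Let x y ∈ M. If M + (x) is
  -- proper, then x ∈ M by maximality. Otherwise 1 = m + d x with m ∈ M, and multiplying by y shows
  -- y ∈ M.
  ⊆prime : ∀ A → 1# ∉ ⟦ A ⟧ → ∃[ P ] IsPrimeIdeal R P × ⟦ A ⟧ ⊆ ⟦ P ⟧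
  ⊆prime A 1∉A = M , record
    { proper = λ M=1 → 1∉M (proj₂ M=1 _)
    ; split  = split
    } , A⊆M
    where
    ProperAbove : Set (lsuc (c ⊔ ℓ))
    ProperAbove = Σ (Ideal R) λ M → ⟦ A ⟧ ⊆ ⟦ M ⟧ × 1# ∉ ⟦ M ⟧

    maximal : Σ ProperAbove λ M → ∀ N → ⟦ proj₁ M ⟧ ⊆ ⟦ proj₁ N ⟧ → ⟦ proj₁ N ⟧ ⊆ ⟦ proj₁ M ⟧
    maximal = maximalMember {b = lsuc (c ⊔ ℓ)} {B = ProperAbove} em proj₁ (A , (λ x∈ → x∈) , 1∉A)

    M : Ideal R
    M = proj₁ (proj₁ maximal)
    A⊆M : ⟦ A ⟧ ⊆ ⟦ M ⟧
    A⊆M = proj₁ (proj₂ (proj₁ maximal))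
    1∉M : 1# ∉ ⟦ M ⟧
    1∉M = proj₂ (proj₂ (proj₁ maximal))

    split : ∀ x y → x * y ∈ ⟦ M ⟧ → x ∈ ⟦ M ⟧ ⊎ y ∈ ⟦ M ⟧
    split x y xy∈M with decide (1# ∈ ⟦ M +⟨ x ⟩ ⟧)
    ... | no 1∉ = inj₁ (proj₂ maximal (M +⟨ x ⟩ , (λ z∈A → ⊆+⟨⟩ M x (A⊆M z∈A)) , 1∉)
                          (⊆+⟨⟩ M x) (∈+⟨⟩ M x))
    ... | yes (m , m∈M , d , 1≈) = inj₂ (Ideal.resp M (sym y≈)
          (Ideal.+-closed M (Ideal.*-closed M y m∈M) (Ideal.*-closed M d xy∈M)))
      where
      open SetoidReasoning setoid
      open SemiringSolver commutativeSemiring using (solve; _:=_; _:+_; _:*_)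
      y≈ : y ≈ y * m + d * (x * y)
      y≈ = begin
        y                    ≈⟨ *-identityʳ y ⟨
        y * 1#               ≈⟨ *-congˡ 1≈ ⟩
        y * (m + d * x)      ≈⟨ solve 4 (λ y m d x → y :* (m :+ d :* x) := y :* m :+ d :* (x :* y))
                                  refl y m d x ⟩
        y * m + d * (x * y)  ∎

-- Fractions and integral dependence in a Dedekind domain.

module Dedekind {c ℓ} (em : ExcludedMiddle (lsuc (c ⊔ ℓ)))
  (R : CommutativeRing c ℓ) (dedekind : IsDedekindDomain R) where

  open CommutativeRing R hiding (zero)
  open RingProperties ring
  open RawSemiringDefs (Semiring.rawSemiring semiring) using (sum)
  open IsDedekindDomain dedekind
  open IsIntegralDomain isIntegralDomain
  open FractionField R isIntegralDomain
  open IdealProperties R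
  open Noetherian em R noetherian
  open SemiringSolver commutativeSemiring using (solve; _:=_; _:+_; _:*_)
  open SetoidReasoning setoid

  private
    module K = RawSemiring fractions
    module KD = RawSemiringDefs fractions

  *-cancelʳ : ∀ {a x y} → ¬ a ≈ 0# → x * a ≈ y * a → x ≈ y
  *-cancelʳ {a} {x} {y} a≉0 xa≈ya with noZeroDivisors (x - y) a
    (trans ([y-z]x≈yx-zx a x y) (AbelianGroupProperties.x≈y⇒x∙y⁻¹≈ε +-abelianGroup xa≈ya))
  ... | inj₁ x-y≈0 = AbelianGroupProperties.x∙y⁻¹≈ε⇒x≈y +-abelianGroup x y x-y≈0
  ... | inj₂ a≈0   = contradiction a≈0 a≉0

  -- z • a ≡ y says that z a = y in the fraction field.
  _•_≡_ : Fraction → Carrier → Carrier → Set ℓ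
  (n / d [ _ ]) • a ≡ y = n * a ≈ y * d

  •-+ : ∀ {z z′ a y y′} → z • a ≡ y → z′ • a ≡ y′ → (z K.+ z′) • a ≡ (y + y′)
  •-+ {n / d [ _ ]} {n′ / d′ [ _ ]} {a} {y} {y′} na≈yd n′a≈y′d′ = begin
    (n * d′ + n′ * d) * a
      ≈⟨ solve 5 (λ n d n′ d′ a → (n :* d′ :+ n′ :* d) :* a := n :* a :* d′ :+ n′ :* a :* d)
           refl n d n′ d′ a ⟩
    n * a * d′ + n′ * a * d
      ≈⟨ +-cong (*-congʳ na≈yd) (*-congʳ n′a≈y′d′) ⟩
    y * d * d′ + y′ * d′ * d
      ≈⟨ solve 4 (λ d d′ y y′ → y :* d :* d′ :+ y′ :* d′ :* d := (y :+ y′) :* (d :* d′))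
           refl d d′ y y′ ⟩
    (y + y′) * (d * d′)  ∎

  •-scale : ∀ {z a y} x → z • a ≡ y → (fromRing x K.* z) • a ≡ (x * y)
  •-scale {n / d [ _ ]} {a} {y} x na≈yd = begin
    x * n * a         ≈⟨ *-assoc x n a ⟩
    x * (n * a)       ≈⟨ *-congˡ na≈yd ⟩
    x * (y * d)       ≈⟨ *-assoc x y d ⟨
    x * y * d         ≈⟨ *-congˡ (*-identityˡ d) ⟨
    x * y * (1# * d)  ∎

  •-sum : ∀ {n a} (z : Vector Fraction n) (x y : Vector Carrier n) → (∀ k → z k • a ≡ y k) →
          KD.sum (λ k → fromRing (x k) K.* z k) • a ≡ sum (λ k → x k * y k)
  •-sum {ℕ.zero}  {a} z x y za≡y = trans (zeroˡ a) (sym (*-identityʳ 0#))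
  •-sum {ℕ.suc n} {a} z x y za≡y =
    •-+ {fromRing (x zero) K.* z zero} {KD.sum (λ k → fromRing (x (suc k)) K.* z (suc k))}
      (•-scale {z zero} (x zero) (za≡y zero)) (•-sum (z ∘ suc) (x ∘ suc) (y ∘ suc) (za≡y ∘ suc))

  -- Multiplication by d / a cannot preserve an ideal: the D-module generated by the elements
  -- y n = (d / a)ⁿ a lies in D, so by the ascending chain condition some y N is a combination
  -- of the earlier ones, which is an equation of integral dependence for d / a.
  module _ {a d} (a≉0 : ¬ a ≈ 0#) (y : ℕ → Carrier) (y₀≈a : y 0 ≈ a)
           (step : ∀ n → y n * d ≈ y (ℕ.suc n) * a) where

    d/a : Fraction
    d/a = d / a [ a≉0 ]

    powers : ∀ n → (d/a KD.^ n) • a ≡ y n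
    powers ℕ.zero    = trans (*-identityˡ a) (trans (sym y₀≈a) (sym (*-identityʳ _)))
    powers (ℕ.suc n) with d/a KD.^ n | powers n
    ... | u / v [ _ ] | ua≈yv = begin
      d * u * a                ≈⟨ *-assoc d u a ⟩
      d * (u * a)              ≈⟨ *-congˡ ua≈yv ⟩
      d * (y n * v)            ≈⟨ solve 3 (λ d y v → d :* (y :* v) := y :* d :* v) refl d (y n) v ⟩
      y n * d * v              ≈⟨ *-congʳ (step n) ⟩
      y (ℕ.suc n) * a * v      ≈⟨ *-assoc _ a v ⟩
      y (ℕ.suc n) * (a * v)    ∎

    vanishes : ∀ z {x} → z • a ≡ x → x ≈ 0# → z K.≈ K.0#
    vanishes (n / v [ _ ]) {x} na≈xv x≈0 = begin
      n * 1#  ≈⟨ *-identityʳ n ⟩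
      n       ≈⟨ *-cancelʳ a≉0 (trans na≈xv (trans (*-congʳ x≈0) (trans (zeroˡ v) (sym (zeroˡ a))))) ⟩
      0#      ≈⟨ zeroˡ v ⟨
      0# * v  ∎

    lowerTerms : ∀ {N} → Vector Carrier N → Fraction
    lowerTerms b = KD.sum (λ k → fromRing (b k) K.* (d/a KD.^ toℕ k))

    root : ∀ N (b : Vector Carrier N) → y N + sum (λ k → b k * y (toℕ k)) ≈ 0# →
           ((d/a KD.^ N) K.+ lowerTerms b) K.≈ K.0#
    root N b y≈0 = vanishes ((d/a KD.^ N) K.+ lowerTerms b)
      {y N + sum (λ k → b k * y (toℕ k))}
      (•-+ {d/a KD.^ N} {lowerTerms b} {a} {y N} {sum (λ k → b k * y (toℕ k))} (powers N)
        (•-sum (λ k → d/a KD.^ toℕ k) b (y ∘ toℕ) (powers ∘ toℕ)))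
      y≈0

    d/a-integral : IsIntegral d/a
    d/a-integral =
      let N , stable = stabilises (λ n → span {n} (y ∘ toℕ)) (span-suc y)
          -- The negative of y N is expanded because `IsIntegral` has the lower terms on the same
          -- side as the leading power.
          b , -yN≈   = stable (neg-closed (span {ℕ.suc N} (y ∘ toℕ)) (last∈span y N))
      in N , b , root N b (trans (+-congˡ (sym -yN≈)) (-‿inverseʳ (y N)))

    -- Integral closure puts d / a into the ring. Membership of 1 in (a) : d means that a divides d.
    a∣d : 1# ∈ ⟦ colon a d ⟧
    a∣d =
      let x , d1≈xa = isIntegrallyClosed d/a d/a-integral
      in x , lift (trans (*-comm 1# d) d1≈xa)

  -- A prime with a nonzero element divides every ideal that it contains.

  module _ {P : Ideal R} (prime : IsPrimeIdeal R P) {a} (a∈P : a ∈ ⟦ P ⟧) (a≉0 : ¬ a ≈ 0#) where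

    open IsPrimeIdeal prime

    1∉P : 1# ∉ ⟦ P ⟧
    1∉P = 1∉prime {P} prime

    *∉P : ∀ {s t} → s ∉ ⟦ P ⟧ → t ∉ ⟦ P ⟧ → s * t ∉ ⟦ P ⟧
    *∉P s∉P t∉P st∈P with split _ _ st∈P
    ... | inj₁ s∈P = s∉P s∈P
    ... | inj₂ t∈P = t∉P t∈P

    nonzero⇒maximal : ∀ {M} → IsPrimeIdeal R M → a ∈ ⟦ M ⟧ → IsMaximalIdeal R M
    nonzero⇒maximal {M} primeM a∈M = prime⇒maximal M primeM λ M≐0 → a≉0 (proj₁ M≐0 a∈M)

    -- The annihilator of b in the localisation of D / (a) at P.
    localColon : Carrier → Ideal R
    localColon b = record
      { ⟦_⟧      = λ x → ∃[ s ] s ∉ ⟦ P ⟧ × x ∈ ⟦ colon a (s * b) ⟧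
      ; resp     = λ { x≈y (s , s∉P , x∈) → s , s∉P , Ideal.resp (colon a (s * b)) x≈y x∈ }
      ; 0∈       = 1# , 1∉P , Ideal.0∈ (colon a (1# * b))
      ; +-closed = λ { (s , s∉P , x∈) (t , t∉P , y∈) → s * t , *∉P s∉P t∉P ,
                       Ideal.+-closed (colon a (s * t * b)) (raiseʳ s t x∈) (raiseˡ s t y∈) }
      ; *-closed = λ { e (s , s∉P , x∈) → s , s∉P , Ideal.*-closed (colon a (s * b)) e x∈ }
      }
      where
      raiseˡ : ∀ s t → ⟦ colon a (t * b) ⟧ ⊆ ⟦ colon a (s * t * b) ⟧
      raiseˡ s t y∈ = colon-cong (sym (*-assoc s t b)) (colon-*ˡ s y∈)

      raiseʳ : ∀ s t → ⟦ colon a (s * b) ⟧ ⊆ ⟦ colon a (s * t * b) ⟧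
      raiseʳ s t x∈ = colon-cong (*-congʳ (*-comm t s)) (raiseˡ t s x∈)

    -- An x outside P is invertible in the localisation. If it killed b there, so would 1, with x
    -- absorbed into the denominator s.
    localColon⊆P : ∀ b → 1# ∉ ⟦ localColon b ⟧ → ⟦ localColon b ⟧ ⊆ ⟦ P ⟧
    localColon⊆P b 1∉ {x} (s , s∉P , x∈) = decidable-stable (decide _) λ x∉P →
      1∉ (x * s , *∉P x∉P s∉P , colon-cong (sym (*-assoc x s b))
                                  (shiftʳ (Ideal.resp (colon a (s * b)) (sym (*-identityˡ x)) x∈)))

    -- Otherwise some s outside P would lie in (a), which is contained in P. This makes the family
    -- of proper local annihilators nonempty.
    localColon-1 : 1# ∉ ⟦ localColon 1# ⟧
    localColon-1 (s , s∉P , w , lift eq) = s∉P (Ideal.resp P (sym s≈wa) (Ideal.*-closed P w a∈P))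
      where
      s≈wa : s ≈ w * a
      s≈wa = begin
        s              ≈⟨ *-identityʳ s ⟨
        s * 1#         ≈⟨ *-identityˡ _ ⟨
        1# * (s * 1#)  ≈⟨ eq ⟩
        w * a          ∎

    Proper : Set (c ⊔ ℓ)
    Proper = ∃[ b ] 1# ∉ ⟦ localColon b ⟧

    Largest : Proper → Set (c ⊔ ℓ)
    Largest (b , _) = ∀ ((b′ , _) : Proper) → ⟦ localColon b ⟧ ⊆ ⟦ localColon b′ ⟧ →
                                              ⟦ localColon b′ ⟧ ⊆ ⟦ localColon b ⟧

    -- This is the argument for associated primes. If y does not kill b, then y b again has a proper
    -- annihilator, and it contains that of b. By maximality the two are equal, and when x y kills
    -- b, x kills y b and hence b.
    localColon-prime : ∀ b → Largest b → IsPrimeIdeal R (localColon (proj₁ b))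
    localColon-prime (b , 1∉) largest = record
      { proper = λ unit → 1∉ (proj₂ unit _)
      ; split  = λ x y xy∈ → splitAt x y xy∈ (decide (y ∈ ⟦ localColon b ⟧))
      }
      where
      swap : ∀ s y → y * (s * b) ≈ s * (y * b)
      swap s y = solve 3 (λ s y b → y :* (s :* b) := s :* (y :* b)) refl s y b

      splitAt : ∀ x y → x * y ∈ ⟦ localColon b ⟧ → Dec (y ∈ ⟦ localColon b ⟧) →
                x ∈ ⟦ localColon b ⟧ ⊎ y ∈ ⟦ localColon b ⟧
      splitAt x y _                  (yes y∈) = inj₂ y∈
      splitAt x y (s , s∉P , xy∈sb) (no y∉)  = inj₁
        (largest (y * b , 1∉yb) b⊆yb (s , s∉P , colon-cong (swap s y) (shiftʳ xy∈sb)))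
        where
        1∉yb : 1# ∉ ⟦ localColon (y * b) ⟧
        1∉yb (t , t∉P , 1∈) = y∉ (t , t∉P , Ideal.resp (colon a (t * b)) (*-identityˡ y)
                                              (shiftˡ (colon-cong (sym (swap t y)) 1∈)))

        b⊆yb : ⟦ localColon b ⟧ ⊆ ⟦ localColon (y * b) ⟧
        b⊆yb (t , t∉P , z∈) = t , t∉P , colon-cong (swap t y) (colon-*ˡ y z∈)

    -- The product of finitely many denominators serves all the elements at once. Applied to
    -- generators of P, this leads from the localisation back to D / (a).
    commonDenominator : ∀ b {n} (g : Vector Carrier n) → (∀ k → g k ∈ ⟦ localColon b ⟧) →
                        ∃[ s ] s ∉ ⟦ P ⟧ × ∀ k → g k ∈ ⟦ colon a (s * b) ⟧
    commonDenominator b {ℕ.zero}  g g∈ = 1# , 1∉P , λ ()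
    commonDenominator b {ℕ.suc n} g g∈ with g∈ zero | commonDenominator b (g ∘ suc) (g∈ ∘ suc)
    ... | s , s∉P , g₀∈ | t , t∉P , g∈t = s * t , *∉P s∉P t∉P , λ where
      zero    → colon-cong (solve 3 (λ s t b → t :* (s :* b) := s :* t :* b) refl s t b) (colon-*ˡ t g₀∈)
      (suc k) → colon-cong (sym (*-assoc s t b)) (colon-*ˡ s (g∈t k))

    -- The largest local annihilator is a prime containing a ≠ 0, hence a maximal ideal. It lies in
    -- the proper ideal P, so it equals P.
    P⊆largest : ∀ b → Largest b → ⟦ P ⟧ ⊆ ⟦ localColon (proj₁ b) ⟧
    P⊆largest (b , 1∉) largest =
      fromMaximal (IsMaximalIdeal.maximal
        (nonzero⇒maximal (localColon-prime (b , 1∉) largest) a∈) P (localColon⊆P b 1∉))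
      where
      a∈ : a ∈ ⟦ localColon b ⟧
      a∈ = 1# , 1∉P , 1# * b , lift (*-comm a (1# * b))

      fromMaximal : (⟦ P ⟧ ≐ ⟦ localColon b ⟧) ⊎ IsUnitIdeal R P → ⟦ P ⟧ ⊆ ⟦ localColon b ⟧
      fromMaximal (inj₁ P≐)   = proj₁ P≐
      fromMaximal (inj₂ unit) = contradiction unit proper

    -- Here d = s b, where b has a largest proper local annihilator and s is a common denominator
    -- for generators of P. If a divided s b, then b would vanish in the localisation.
    P⊆colon : ∃[ d ] ⟦ P ⟧ ⊆ ⟦ colon a d ⟧ × 1# ∉ ⟦ colon a d ⟧
    P⊆colon =
      let (b , 1∉) , largest   = maximalMember {b = c} {B = Proper} (λ {X} → decide X)
                                   (localColon ∘ proj₁) (1# , localColon-1)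
          n , g , P⊆span , span⊆P = noetherian P
          s , s∉P , g∈ = commonDenominator b g λ k →
                           P⊆largest (b , 1∉) largest (span⊆P (generator∈span g k))
      in s * b , (λ p∈P → span⊆ (colon a (s * b)) g g∈ (P⊆span p∈P)) , λ 1∈ → 1∉ (s , s∉P , 1∈)

    -- If multiplication by d / a mapped P into itself, its iterates on a would stay in P, and `a∣d`
    -- would make a divide d.
    escape : ∀ {d} → ⟦ P ⟧ ⊆ ⟦ colon a d ⟧ → 1# ∉ ⟦ colon a d ⟧ →
             ∃[ p ] p ∈ ⟦ P ⟧ × ∃[ w ] w ∉ ⟦ P ⟧ × p * d ≈ w * a
    escape {d} P⊆ 1∉ = decidable-stable (decide _) λ none →
      let next : ∃[ p ] p ∈ ⟦ P ⟧ → ∃[ p ] p ∈ ⟦ P ⟧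
          next (p , p∈P) = proj₁ (P⊆ p∈P) , decidable-stable (decide _) λ w∉P →
            none (p , p∈P , proj₁ (P⊆ p∈P) , w∉P , lower (proj₂ (P⊆ p∈P)))
          y : ℕ → ∃[ p ] p ∈ ⟦ P ⟧
          y = fold (a , a∈P) next
      in 1∉ (a∣d a≉0 (proj₁ ∘ y) refl λ n → lower (proj₂ (P⊆ (proj₂ (y n)))))

    module _ {d} (P⊆ : ⟦ P ⟧ ⊆ ⟦ colon a d ⟧) {p} (p∈P : p ∈ ⟦ P ⟧) {w} (w∉P : w ∉ ⟦ P ⟧)
             (pd≈wa : p * d ≈ w * a) (J : Ideal R) (J⊆P : ⟦ J ⟧ ⊆ ⟦ P ⟧) where

      private
        module J = Ideal J

      -- The largest ideal whose product with P lies in J, and therefore the natural candidate for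
      -- the cofactor.
      J∶P : Ideal R
      J∶P = record
        { ⟦_⟧      = λ y → ∀ {q} → q ∈ ⟦ P ⟧ → q * y ∈ ⟦ J ⟧
        ; resp     = λ x≈y x∈ q∈P → J.resp (*-congˡ x≈y) (x∈ q∈P)
        ; 0∈       = λ _ → J.resp (sym (zeroʳ _)) J.0∈
        ; +-closed = λ x∈ y∈ q∈P → J.resp (sym (distribˡ _ _ _)) (J.+-closed (x∈ q∈P) (y∈ q∈P))
        ; *-closed = λ e {x} x∈ {q} q∈P →
            J.resp (solve 3 (λ e q x → e :* (q :* x) := q :* (e :* x)) refl e q x)
              (J.*-closed e (x∈ q∈P))
        }

      P·J∶P⊆J : _·_ R P J∶P ⊆ ⟦ J ⟧
      P·J∶P⊆J (n , x , y , x∈P , y∈ , j≈) = J.resp (sym j≈) (sum-closed J _ λ k → y∈ k (x∈P k))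

      1∈P+w : 1# ∈ ⟦ P +⟨ w ⟩ ⟧
      1∈P+w = fromMaximal
        (IsMaximalIdeal.maximal (nonzero⇒maximal prime a∈P) (P +⟨ w ⟩) (⊆+⟨⟩ P w))
        where
        fromMaximal : (⟦ P +⟨ w ⟩ ⟧ ≐ ⟦ P ⟧) ⊎ IsUnitIdeal R (P +⟨ w ⟩) → 1# ∈ ⟦ P +⟨ w ⟩ ⟧
        fromMaximal (inj₁ P+w≐P) = contradiction (proj₁ P+w≐P (∈+⟨⟩ P w)) w∉P
        fromMaximal (inj₂ unit)  = proj₂ unit _

      -- If 1 = q + e w with q ∈ P and p d = w a, then j = q j + (e p) (j d / a) for j ∈ J.
      J⊆P·J∶P : ⟦ J ⟧ ⊆ _·_ R P J∶P
      J⊆P·J∶P {j} j∈J with 1∈P+w | P⊆ (J⊆P j∈J)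
      ... | q , q∈P , e , 1≈q+ew | z , lift jd≈za =
        2 , q Vector.∷ e * p Vector.∷ Vector.[] , j Vector.∷ z Vector.∷ Vector.[] ,
        (λ { zero → q∈P ; (suc zero) → Ideal.*-closed P e p∈P }) ,
        (λ { zero {q′} _ → J.*-closed q′ j∈J ; (suc zero) → z∈J∶P }) ,
        j≈
        where
        -- In the fraction field w = p d / a and z = j d / a, so both sides are p j d / a.
        wj≈pz : w * j ≈ p * z
        wj≈pz = *-cancelʳ a≉0 (begin
          w * j * a    ≈⟨ solve 3 (λ w j a → w :* j :* a := w :* a :* j) refl w j a ⟩
          w * a * j    ≈⟨ *-congʳ pd≈wa ⟨
          p * d * j    ≈⟨ solve 3 (λ p d j → p :* d :* j := p :* (j :* d)) refl p d j ⟩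
          p * (j * d)  ≈⟨ *-congˡ jd≈za ⟩
          p * (z * a)  ≈⟨ *-assoc p z a ⟨
          p * z * a    ∎)

        j≈ : j ≈ q * j + (e * p * z + 0#)
        j≈ = begin
          j                          ≈⟨ *-identityˡ j ⟨
          1# * j                     ≈⟨ *-congʳ 1≈q+ew ⟩
          (q + e * w) * j            ≈⟨ solve 4 (λ q e w j → (q :+ e :* w) :* j := q :* j :+ e :* (w :* j))
                                          refl q e w j ⟩
          q * j + e * (w * j)        ≈⟨ +-congˡ (*-congˡ wj≈pz) ⟩
          q * j + e * (p * z)        ≈⟨ +-congˡ (*-assoc e p z) ⟨
          q * j + e * p * z          ≈⟨ +-congˡ (+-identityʳ _) ⟨
          q * j + (e * p * z + 0#)   ∎

        -- With v = x d / a, which lies in D because x ∈ P, the product x z = x j d / a equals v j.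
        z∈J∶P : ∀ {x} → x ∈ ⟦ P ⟧ → x * z ∈ ⟦ J ⟧
        z∈J∶P {x} x∈P with P⊆ x∈P
        ... | v , lift xd≈va = J.resp (*-cancelʳ a≉0 (begin
          v * j * a    ≈⟨ solve 3 (λ v j a → v :* j :* a := v :* a :* j) refl v j a ⟩
          v * a * j    ≈⟨ *-congʳ xd≈va ⟨
          x * d * j    ≈⟨ solve 3 (λ x d j → x :* d :* j := x :* (j :* d)) refl x d j ⟩
          x * (j * d)  ≈⟨ *-congˡ jd≈za ⟩
          x * (z * a)  ≈⟨ *-assoc x z a ⟨
          x * z * a    ∎)) (J.*-closed v j∈J)

      divides : _Divides_ R P J
      divides = J∶P , J⊆P·J∶P , P·J∶P⊆J

    prime⊇⇒divides : ∀ J → ⟦ J ⟧ ⊆ ⟦ P ⟧ → _Divides_ R P J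
    prime⊇⇒divides J J⊆P =
      let d , P⊆ , 1∉               = P⊆colon
          p , p∈P , w , w∉P , pd≈wa = escape P⊆ 1∉
      in divides P⊆ p∈P w∉P pd≈wa J J⊆P

  -- Units modulo J.

  nonzeroMember : ∀ J → ¬ IsZeroIdeal R J → ∃[ a ] a ∈ ⟦ J ⟧ × ¬ a ≈ 0#
  nonzeroMember J J≢0 = decidable-stable (decide _) λ none → J≢0
    ( (λ {a} a∈J → decidable-stable (≈? a 0#) λ a≉0 → none (a , a∈J , a≉0))
    , (λ a≈0 → Ideal.resp J (sym a≈0) (Ideal.0∈ J)) )

  -- If 1 = j + u x with j ∈ J, then u x - 1 = - j. If J + (x) is proper, a prime above it contains
  -- a nonzero element of J, so it divides J, and it also contains x.
  unitModulo : ∀ J → ¬ IsZeroIdeal R J → ∀ x →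
               (∀ P → IsPrimeIdeal R P → _Divides_ R P J → x ∉ ⟦ P ⟧) →
               ∃[ u ] _≡_mod_ R (u * x) 1# J
  unitModulo J J≢0 x coprime with decide (1# ∈ ⟦ J +⟨ x ⟩ ⟧)
  ... | yes (j , j∈J , u , 1≈j+ux) = u , Ideal.resp J -j≈ (neg-closed J j∈J)
    where
    -j≈ : - j ≈ u * x - 1#
    -j≈ = begin
      - j                          ≈⟨ +-identityʳ (- j) ⟨
      - j + 0#                     ≈⟨ +-congˡ (-‿inverseʳ 1#) ⟨
      - j + (1# - 1#)              ≈⟨ +-congˡ (+-congʳ 1≈j+ux) ⟩
      - j + ((j + u * x) - 1#)     ≈⟨ solve 4 (λ n j t m → n :+ ((j :+ t) :+ m) := (n :+ j) :+ (t :+ m))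
                                        refl (- j) j (u * x) (- 1#) ⟩
      (- j + j) + (u * x - 1#)     ≈⟨ +-congʳ (-‿inverseˡ j) ⟩
      0# + (u * x - 1#)            ≈⟨ +-identityˡ _ ⟩
      u * x - 1#                   ∎
  ... | no 1∉ with ⊆prime (J +⟨ x ⟩) 1∉ | nonzeroMember J J≢0
  ...   | P , prime , J+x⊆P | a , a∈J , a≉0 = contradiction (J+x⊆P (∈+⟨⟩ J x))
    (coprime P prime (prime⊇⇒divides {P} prime (J⊆P a∈J) a≉0 J J⊆P))
    where
    J⊆P : ⟦ J ⟧ ⊆ ⟦ P ⟧
    J⊆P z∈J = J+x⊆P (⊆+⟨⟩ J x z∈J)

-- Lists of dependent tuples.

module Tuple where

  private variable
    a p : Level
    r   : ℕ

  cons : {A : Fin (ℕ.suc r) → Set a} → A zero → (∀ i → A (suc i)) → ∀ i → A i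
  cons x t zero    = x
  cons x t (suc i) = t i

  allTuples : {A : Fin r → Set a} → (∀ i → List (A i)) → List (∀ i → A i)
  allTuples {ℕ.zero}  xs = (λ ()) ∷ []
  allTuples {ℕ.suc r} {A = A} xs = cartesianProductWith (cons {A = A}) (xs zero) (allTuples (xs ∘ suc))

  allTuples⁺ : {A : Fin r → Set a} {P : ∀ i → Pred (A i) p} (xs : ∀ i → List (A i)) →
               (∀ i → Any (P i) (xs i)) → Any (λ t → ∀ i → P i (t i)) (allTuples xs)
  allTuples⁺ {ℕ.zero}  xs any = here λ ()
  allTuples⁺ {ℕ.suc r} {A = A} xs any =
    Any.cartesianProductWith⁺ (cons {A = A})
      (λ p ps → λ { zero → p ; (suc i) → ps i }) (any zero) (allTuples⁺ (xs ∘ suc) (any ∘ suc))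

-- The two implications of the theorem.

module Main {c ℓ} (em : ExcludedMiddle (lsuc (c ⊔ ℓ)))
  (D : CommutativeRing c ℓ) (dedekind : IsDedekindDomain D) {r : ℕ}
  (I : Fin r → Ideal D) (J : Ideal D) (𝒟 : ∀ i → CompleteResidues D (I i)) where

  open CommutativeRing D hiding (zero)
  open IdealProperties D
  open Noetherian em D (IsDedekindDomain.noetherian dedekind) using (≈?)

  Separating : Set (lsuc (c ⊔ ℓ))
  Separating = ∀ i (P : Ideal D) → IsPrimeIdeal D P → _Divides_ D P J →
    ∀ x y → x ∈ elements (𝒟 i) → y ∈ elements (𝒟 i) → ¬ (x ≈ y) → ¬ (_≡_mod_ D x y P)

  -- Congruence modulo P is the equality of the quotient ring, which evaluation over that ring
  -- respects.
  evaluate-mod : ∀ P (F : Polynomial D r) {x y : Vector Carrier r} →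
                 (∀ i → _≡_mod_ D (x i) (y i) P) → _≡_mod_ D (evaluate D F x) (evaluate D F y) P
  evaluate-mod P F {x} {y} x≡y = ≡.subst₂ (λ a b → _≡_mod_ D a b P)
    (evaluate-quotient P F x) (evaluate-quotient P F y)
    (Polynomials.evaluate-cong (quotient P) F {x} {y} x≡y)

  module _ (0∈𝒟 : ∀ i → 0# ∈ elements (𝒟 i)) where

    -- The tuple with x at place i and 0 elsewhere. `coordinate` pairs each value with its
    -- membership proof, so one case distinction settles both.
    single : ∀ i {x} → x ∈ elements (𝒟 i) → Setoid.Carrier (Tuples D 𝒟)
    single i {x} x∈ = (λ j → proj₁ (coordinate j)) , (λ j → proj₂ (coordinate j))
      where
      coordinate : ∀ j → ∃[ b ] b ∈ elements (𝒟 j)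
      coordinate j with i ≟ᶠ j
      ... | yes ≡.refl = x , x∈
      ... | no _       = 0# , 0∈𝒟 j

    single-i : ∀ i {x} (x∈ : x ∈ elements (𝒟 i)) → proj₁ (single i x∈) i ≈ x
    single-i i x∈ with i ≟ᶠ i
    ... | yes ≡.refl = refl
    ... | no i≢i     = contradiction ≡.refl i≢i

    single-cong : ∀ P i {x y} (x∈ : x ∈ elements (𝒟 i)) (y∈ : y ∈ elements (𝒟 i)) →
                  _≡_mod_ D x y P → ∀ j → _≡_mod_ D (proj₁ (single i x∈) j) (proj₁ (single i y∈) j) P
    single-cong P i x∈ y∈ x≡y j with i ≟ᶠ j
    ... | yes ≡.refl = x≡y
    ... | no _       = Setoid.refl (Residues D P)

    choose : ∀ {p} {X : Set p} → Dec X → Carrier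
    choose (yes _) = 1#
    choose (no _)  = 0#

    choose-⇔ : ∀ {p q} {X : Set p} {Y : Set q} (X? : Dec X) (Y? : Dec Y) →
               (X → Y) → (Y → X) → choose X? ≈ choose Y?
    choose-⇔ (yes _) (yes _) _   _   = refl
    choose-⇔ (yes x) (no ¬y) X→Y _   = contradiction (X→Y x) ¬y
    choose-⇔ (no ¬x) (yes y) _   Y→X = contradiction (Y→X y) ¬x
    choose-⇔ (no _)  (no _)  _   _   = refl

    choose-yes : ∀ {p} {X : Set p} (X? : Dec X) → X → choose X? ≈ 1#
    choose-yes (yes _) _ = refl
    choose-yes (no ¬x) x = contradiction x ¬x

    choose-no : ∀ {p} {X : Set p} (X? : Dec X) → ¬ X → choose X? ≈ 0#
    choose-no (yes x) ¬x = contradiction x ¬x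
    choose-no (no _)  _  = refl

    indicator : Fin r → Carrier → Func (Tuples D 𝒟) (Residues D J)
    indicator i x = record
      { to   = λ b → choose (≈? (proj₁ b i) x)
      ; cong = λ {b} {b′} b≋b′ → ≈⇒≡mod J
          (choose-⇔ (≈? (proj₁ b i) x) (≈? (proj₁ b′ i) x) (trans (sym (b≋b′ i))) (trans (b≋b′ i)))
      }

    -- The indicator is 1 at the tuple of x and 0 at that of y. The representing polynomial has
    -- congruent values there modulo P, and J ⊆ P turns agreement modulo J into agreement modulo P.
    -- Hence 1 ∈ P.
    allPolynomial⇒separating :
      ((f : Func (Tuples D 𝒟) (Residues D J)) → IsPolynomialFunction D 𝒟 J f) → Separating
    allPolynomial⇒separating polynomial i P prime P∣J x y x∈ y∈ x≉y x≡y =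
      1∉prime {P} prime (Ideal.resp P 1-0≈1 (begin
        1#                                       ≈⟨ ≈⇒≡mod P (choose-yes (≈? _ x) (single-i i x∈)) ⟨
        Func.to (indicator i x) (single i x∈)    ≈⟨ J⊆P (F≡ (single i x∈)) ⟨
        evaluate D F (proj₁ (single i x∈))       ≈⟨ evaluate-mod P F (single-cong P i x∈ y∈ x≡y) ⟩
        evaluate D F (proj₁ (single i y∈))       ≈⟨ J⊆P (F≡ (single i y∈)) ⟩
        Func.to (indicator i x) (single i y∈)    ≈⟨ ≈⇒≡mod P (choose-no (≈? _ x) (λ y≈x → x≉y (trans (sym y≈x) (single-i i y∈)))) ⟩
        0#                                       ∎))
      where
      open SetoidReasoning (Residues D P)
      F : Polynomial D r
      F = proj₁ (polynomial (indicator i x))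
      F≡ : ∀ b → _≡_mod_ D (evaluate D F (proj₁ b)) (Func.to (indicator i x) b) J
      F≡ = proj₂ (polynomial (indicator i x))
      J⊆P : ⟦ J ⟧ ⊆ ⟦ P ⟧
      J⊆P = divides⇒⊇ {P} {J} P∣J
      1-0≈1 : 1# - 0# ≈ 1#
      1-0≈1 = trans (+-congˡ (RingProperties.-0#≈0# ring)) (+-identityʳ 1#)

  -- Interpolation of an arbitrary function under the separation condition.

  module _ (finite : ∀ i → Finite (Residues D (I i))) (J≢0 : ¬ IsZeroIdeal D J)
           (separating : Separating) (f : Func (Tuples D 𝒟) (Residues D J)) where

    -- A family of pairs, unlike the pair of families in `Tuples`: this is the form in which
    -- coordinate lists are combined by `allTuples`.
    Tuple : Set (c ⊔ ℓ)
    Tuple = ∀ i → ∃[ b ] b ∈ elements (𝒟 i)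

    fromTuple : Tuple → Setoid.Carrier (Tuples D 𝒟)
    fromTuple t = proj₁ ∘ t , proj₂ ∘ t

    representative : ∀ i → Fin (proj₁ (finite i)) → ∃[ b ] b ∈ elements (𝒟 i)
    representative i k =
      let s , s∈ , _ = CompleteResidues.exists (𝒟 i) (Inverse.from (proj₂ (finite i)) k) in s , s∈

    representatives : ∀ i → List (∃[ b ] b ∈ elements (𝒟 i))
    representatives i = List.map (representative i) (allFin (proj₁ (finite i)))

    -- An element b and the representative listed for its class are congruent modulo I_i, and
    -- uniqueness of residues makes them equal. So finiteness of D / I_i passes to the residue
    -- system.
    ∈representatives : ∀ i {b} → b ∈ elements (𝒟 i) → Any (λ s → b ≈ proj₁ s) (representatives i)
    ∈representatives i {b} b∈ =
      Any.map⁺ (Any.map (λ { ≡.refl → b≈ }) (∈-allFin (Inverse.to (proj₂ (finite i)) b)))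
      where
      open Inverse (proj₂ (finite i)) using (to; from; inverseʳ)
      exists = CompleteResidues.exists (𝒟 i) (from (to b))

      b≈ : b ≈ proj₁ (representative i (to b))
      b≈ = CompleteResidues.unique (𝒟 i) b∈ (proj₁ (proj₂ exists))
             (Setoid.trans (Residues D (I i)) (Setoid.sym (Residues D (I i)) (inverseʳ ≡.refl))
               (proj₂ (proj₂ exists)))

    -- Interpolation takes place over D / J, where `unitModulo` makes differences of distinct
    -- residues invertible.
    open Polynomials.Interpolation (quotient J) (λ (t : Tuple) → proj₁ ∘ t) (Func.to f ∘ fromTuple)

    -- Equal coordinates give equal values because f respects equality of tuples. Otherwise some
    -- coordinates differ, and by hypothesis their difference lies in no prime divisor of J.
    agreeOrSeparated : ∀ s t → Agree s t ⊎ Separated s t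
    agreeOrSeparated s t with all? (λ i → ≈? (proj₁ (s i)) (proj₁ (t i)))
    ... | yes s≋t = inj₁ ((λ i → ≈⇒≡mod J (s≋t i)) , Func.cong f s≋t)
    ... | no s≭t  =
      let i , si≉ti = ¬∀⟶∃¬ r _ (λ i → ≈? (proj₁ (s i)) (proj₁ (t i))) s≭t
      in inj₂ (i , Dedekind.unitModulo em D dedekind J J≢0 _ λ P prime P∣J →
           separating i P prime P∣J _ _ (proj₂ (s i)) (proj₂ (t i)) si≉ti)

    separating⇒polynomial : IsPolynomialFunction D 𝒟 J f
    separating⇒polynomial =
      let F , F≡ = interpolate agreeOrSeparated (Tuple.allTuples representatives)
      in F , λ (b , b∈) → nearby F b b∈ (All.map (λ {t} → inQuotient F t) F≡)
               (Tuple.allTuples⁺ representatives (λ i → ∈representatives i (b∈ i)))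
      where
      open SetoidReasoning (Residues D J)
      inQuotient : ∀ (F : Polynomial D r) t →
                   _≡_mod_ D (evaluate (quotient J) F (proj₁ ∘ t)) (Func.to f (fromTuple t)) J →
                   _≡_mod_ D (evaluate D F (proj₁ ∘ t)) (Func.to f (fromTuple t)) J
      inQuotient F t = ≡.subst (λ a → _≡_mod_ D a (Func.to f (fromTuple t)) J)
                         (evaluate-quotient J F (proj₁ ∘ t))

      -- An arbitrary tuple equals a listed one only coordinatewise up to `≈`. Both evaluation and f
      -- respect this, which carries the congruence over.
      nearby : ∀ F b (b∈ : ∀ i → b i ∈ elements (𝒟 i)) {ts} →
               All (λ t → _≡_mod_ D (evaluate D F (proj₁ ∘ t)) (Func.to f (fromTuple t)) J) ts →
               Any (λ t → ∀ i → b i ≈ proj₁ (t i)) ts →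
               _≡_mod_ D (evaluate D F b) (Func.to f (b , b∈)) J
      nearby F b b∈ (_ ∷ F≡)            (there any)    = nearby F b b∈ F≡ any
      nearby F b b∈ (_∷_ {x = t} F≡ _)  (here b≋t) = begin
        evaluate D F b             ≈⟨ ≈⇒≡mod J (Polynomials.evaluate-cong D F b≋t) ⟩
        evaluate D F (proj₁ ∘ t)   ≈⟨ F≡ ⟩
        Func.to f (fromTuple t)    ≈⟨ Func.cong f b≋t ⟨
        Func.to f (b , b∈)         ∎

mainTheorem1 : ∀ {c ℓ} → ExcludedMiddle (lsuc (c ⊔ ℓ)) →
    (D : CommutativeRing c ℓ) → IsDedekindDomain D →
    let open CommutativeRing D in
    (r : ℕ) → 1 ≤ r →
    (I : Fin r → Ideal D) (J : Ideal D) →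
    (∀ i → ¬ IsZeroIdeal D (I i)) → (∀ i → ¬ IsUnitIdeal D (I i)) →
    ¬ IsZeroIdeal D J → ¬ IsUnitIdeal D J →
    (∀ i → Finite (Residues D (I i))) →
    (𝒟 : ∀ i → CompleteResidues D (I i)) →
    (∀ i → 0# ∈ elements (𝒟 i)) →
    ((f : Func (Tuples D 𝒟) (Residues D J)) → IsPolynomialFunction D 𝒟 J f)
    ⇔
    (∀ i (P : Ideal D) → IsPrimeIdeal D P → _Divides_ D P J →
    ∀ x y → x ∈ elements (𝒟 i) → y ∈ elements (𝒟 i) →
    ¬ (x ≈ y) → ¬ (_≡_mod_ D x y P))
mainTheorem1 em D dedekind r _ I J _ _ J≢0 _ finite 𝒟 0∈𝒟 =
  mk⇔ (Main.allPolynomial⇒separating em D dedekind I J 𝒟 0∈𝒟)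
      (Main.separating⇒polynomial em D dedekind I J 𝒟 finite J≢0)
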